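{- Let $w$ be the weight system of height $1$ on the lecture hall graph defined by $w(0;i,j)=q^{ -i-j-1}$ for $0\le j\le i$ (and $w(t;i,j)=0$ for $t\ge1$). Then for all $n\ge k\ge0$, \[ h^w_{n,k}=\sigma_{n,k}, \] where $\sigma_{n,k}$ are the mixed moments of the Stieltjes--Wigert polynomials.
   Context: Lecture hall graph. For integers $t\ge0$, $0\le j\le i$ put $v^t_{i,j}=(i,\,t+\frac{j}{i+1})$, and set $v^t_{i,i+1}:=v^{t+1}_{i,0}$. The vertices of the lecture hall graph are all $v^t_{i,j}$; its edges join $v^t_{i,j}$ with $v^t_{i,j+1}$ (vertical edges) and $v^t_{i,j}$ with $v^t_{i+1,j}$, for $t\ge 0$, $0\le j\le i$. An east step is a directed edge $(v^t_{i,j},v^t_{i+1,j})$; a south step is a vertical edge directed downwards, $(v^t_{i,j+1},v^t_{i,j})$. A weight system $w$ assigns a weight $w(t;i,j)$ to each east step $(v^t_{i,j},v^t_{i+1,j})$; its height is the smallest integer $\ell$ with $w(t;i,j)=0$ for all $t\ge\ell$. The weight $w(p)$ of a path is the product of the weights of its east steps. $\mathrm{SE}((k,\infty)\to(n,0))$ is the set of paths $(\dots,v_2,v_1,v_0)$ with $v_0=(n,0)$, $\lim_{m\to\infty}v_m=(k,\infty)$, and each $(v_{m+1},v_m)$ a south or east step. Define $h^w_{n,k}=\sum_{p\in \mathrm{SE}((k,\infty)\to(n,0))}w(p)$. Stieltjes--Wigert polynomials. The monic Stieltjes--Wigert polynomials are \[ S_n(x;q)=(-1)^nq^{ -n^2}\;{}_1\phi_1\!\left(\begin{matrix}q^{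 -n}\\0\end{matrix};q,-q^{n+1}x\right), \] where ${}_1\phi_1(\alpha;\beta;q,z)=\sum_{k\ge0}\frac{(\alpha;q)_k}{(q;q)_k(\beta;q)_k}(-1)^kq^{\binom k2}z^k$ and $(z;q)_k=\prod_{i=0}^{k-1}(1-zq^i)$. Their mixed moments are defined by $x^n=\sum_{k=0}^n\sigma_{n,k}S_k(x;q)$. Here $q$ is an indeterminate. -}

module Defs where

open import Level using (_⊔_; 0ℓ)
open import Data.Nat.Base as ℕ using (ℕ; zero; suc; _≤_; _<_; z≤n; s≤s)
open import Data.Nat.Properties as ℕ using (≤-refl; <⇒≤)
import Data.Nat.Combinatorics as ℕ
open import Data.Integer.Base using (ℤ; +_; -[1+_])
open import Data.Rational.Unnormalised.Base as ℚᵘ using (ℚᵘ)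
open import Data.Fin.Base using (Fin; toℕ)
open import Data.Bool.Base using (if_then_else_)
open import Data.List.Base using (List; []; _∷_; _++_; [_]; map; foldr; replicate)
open import Data.List.Relation.Unary.Any using (Any; here; there)
open import Data.Product.Base using (∃-syntax; _×_; _,_; proj₁)
open import Relation.Nullary.Negation using (contradiction)
open import Relation.Binary.Bundles using (Setoid)
open import Relation.Binary.PropositionalEquality as ≡ using (_≡_; _≢_)
import Data.List.Relation.Unary.Unique.Setoid as UniqueSetoid
import Data.List.Membership.Setoid as MembershipSetoid
open import Algebra.Bundles using (CommutativeRing; Semiring)
open import Algebra.Apartness.Bundles using (HeytingField)
import Algebra.Apartness.Properties.HeytingCommutativeRing as HCRProperties
import Algebra.Definitions.RawMonoid as RawMonoidDefs
import Algebra.Definitions.RawSemiring as RawSemiringDefs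
import Algebra.Properties.Ring as RingProperties
import Relation.Binary.Reasoning.Setoid as ≈-Reasoning

-- `vertex t i j` is v^t_{i,j}, the point (i, t + j/(i+1)) of the plane.  As
-- 0 ≤ j ≤ i, different triples give different points.

record Vertex : Set where
  constructor vertex
  field
    level   : ℕ
    col     : ℕ
    pos     : ℕ
    .pos≤col : pos ≤ col

open Vertex public

height : Vertex → ℚᵘ
height (vertex t i j _) = (+ t ℚᵘ./ 1) ℚᵘ.+ (+ j ℚᵘ./ suc i)

-- The convention v^t_{i,i+1} = v^{t+1}_{i,0} is the second kind of south step.

data SouthStep : Vertex → Vertex → Set where
  within : ∀ {t i j} (j<i : j < i) →
           SouthStep (vertex t i (suc j) j<i) (vertex t i j (<⇒≤ j<i))
  across : ∀ {t i} →
           SouthStep (vertex (suc t) i 0 z≤n) (vertex t i i ≤-refl)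

data EastStep : Vertex → Vertex → Set where
  east : ∀ {t i j} .(j≤i : j ≤ i) →
         EastStep (vertex t i j j≤i) (vertex t (suc i) j (ℕ.m≤n⇒m≤1+n j≤i))

data Step (u v : Vertex) : Set where
  south : SouthStep u v → Step u v
  east  : EastStep u v → Step u v

-- SE k n is SE((k,∞) → (n,0)): infinite paths (…, v₂, v₁, v₀), indexed from
-- their end.  First coordinates are integers, so converging to k means being
-- eventually equal to k.

record SE (k n : ℕ) : Set where
  field
    v         : ℕ → Vertex
    v₀        : v 0 ≡ vertex 0 n 0 z≤n
    step      : ∀ m → Step (v (suc m)) (v m)
    col-lim   : ∃[ N ] ∀ m → N ≤ m → col (v m) ≡ k
    height-lim : ∀ (B : ℕ) → ∃[ M ] ∀ m → M ≤ m → (+ B ℚᵘ./ 1) ℚᵘ.≤ height (v m)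

-- Two paths are equal when they visit the same vertices.

SE-setoid : ℕ → ℕ → Setoid 0ℓ 0ℓ
SE-setoid k n = record
  { Carrier = SE k n
  ; _≈_ = λ p p′ → ∀ m → SE.v p m ≡ SE.v p′ m
  ; isEquivalence = record
    { refl  = λ _ → ≡.refl
    ; sym   = λ e m → ≡.sym (e m)
    ; trans = λ e e′ m → ≡.trans (e m) (e′ m)
    }
  }

module OverField {c ℓ₁ ℓ₂} (K : HeytingField c ℓ₁ ℓ₂) where

  open HeytingField K
  open HCRProperties heytingCommutativeRing using (1#0; x#0y#0→xy#0; #-congʳ; x-0≈x)

  commutativeRing : CommutativeRing c ℓ₁
  commutativeRing = record { isCommutativeRing = isCommutativeRing }

  open CommutativeRing commutativeRing using (semiring; ring; +-rawMonoid; *-rawMonoid; _≉_)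
  open RawSemiringDefs (Semiring.rawSemiring semiring) public using (_^_)
  open RawMonoidDefs +-rawMonoid public using (sum) renaming (_×_ to _·_)
  open RawMonoidDefs *-rawMonoid public using () renaming (sum to product)
  open RingProperties ring using (-‿distribʳ-*)

  -- w t i j _ is the weight of the east step (v^t_{i,j}, v^t_{i+1,j}).

  WeightSystem : Set c
  WeightSystem = (t i j : ℕ) → .(j ≤ i) → Carrier

  VanishesFrom : WeightSystem → ℕ → Set ℓ₁
  VanishesFrom w ℓ = ∀ t i j .(j≤i : j ≤ i) → ℓ ≤ t → w t i j j≤i ≈ 0#

  HasHeight : WeightSystem → ℕ → Set ℓ₁
  HasHeight w ℓ = VanishesFrom w ℓ × (∀ ℓ′ → VanishesFrom w ℓ′ → ℓ ≤ ℓ′)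

  stepWeight : WeightSystem → ∀ {u v} → Step u v → Carrier
  stepWeight w (south _)                         = 1#
  stepWeight w (east (east {t} {i} {j} j≤i)) = w t i j j≤i

  -- With N from `col-lim`, the first N steps, counted from the end of the
  -- path, include all of its east steps.

  pathWeight : WeightSystem → ∀ {k n} → SE k n → Carrier
  pathWeight w p = product {proj₁ col-lim} (λ m → stepWeight w (step (toℕ m)))
    where open SE p

  -- HasSum S f s: at most finitely many x in S have f x ≉ 0, and the sum of
  -- f over S, which then makes sense for infinite S, is s.

  HasSum : ∀ {a r} (S : Setoid a r) → (Setoid.Carrier S → Carrier) → Carrier →
           Set (a ⊔ r ⊔ ℓ₁)
  HasSum S f s =
    ∃[ xs ] Unique xs × (∀ x → f x ≉ 0# → x ∈ xs) × foldr _+_ 0# (map f xs) ≈ s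
    where
    open UniqueSetoid S using (Unique)
    open MembershipSetoid S using (_∈_)

  -- HEquals w n k s: h^w_{n,k} = s

  HEquals : WeightSystem → ℕ → ℕ → Carrier → Set ℓ₁
  HEquals w n k s = HasSum (SE-setoid k n) (pathWeight w) s

  fromℤ : ℤ → Carrier
  fromℤ (+ n)    = n · 1#
  fromℤ -[1+ n ] = - (suc n · 1#)

  -- The value at x of the polynomial with the given coefficients, constant
  -- term first.

  eval : List ℤ → Carrier → Carrier
  eval []       x = 0#
  eval (a ∷ as) x = fromℤ a + x * eval as x

  -- q is an indeterminate in K: no nonzero integer polynomial vanishes at q,
  -- that is, K has characteristic 0 and contains the field ℚ(q) of rational
  -- functions.

  IsIndeterminate : Carrier → Set ℓ₂
  IsIndeterminate q = ∀ as → Any (_≢ + 0) as → eval as q # 0#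

  inverse : ∀ {x} → x # 0# → Carrier
  inverse x#0 = proj₁ (#⇒invertible x#0)

  inverseˡ : ∀ {x} (x#0 : x # 0#) → inverse x#0 * x ≈ 1#
  inverseˡ {x} x#0 with x⁻¹ , invˡ , _ ← #⇒invertible x#0 =
    trans (*-congˡ (sym (x-0≈x x))) invˡ

  -- Formal power series over K in one variable, as coefficient sequences;
  -- polynomials are among them.

  Series : Set c
  Series = ℕ → Carrier

  infix 4 _≋_
  _≋_ : Series → Series → Set ℓ₁
  f ≋ g = ∀ m → f m ≈ g m

  X^_ : ℕ → Series
  (X^ n) m = if n ℕ.≡ᵇ m then 1# else 0#

  infixr 7 _•_
  _•_ : Carrier → Series → Series
  (a • f) m = a * f m

  -- f(z) ↦ f(a x)
  dilate : Carrier → Series → Series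
  dilate a f m = a ^ m * f m

  Σ[k≤_] : ℕ → (ℕ → Series) → Series
  Σ[k≤ n ] f m = sum {suc n} (λ k → f (toℕ k) m)

  -- (z;q)_k
  poch : Carrier → Carrier → ℕ → Carrier
  poch z q k = product {k} (λ i → 1# - z * q ^ toℕ i)

  -- ₁φ₁(α;β;q,z) as a power series in z
  φ : (α β q : Carrier) → (∀ k → poch q q k * poch β q k # 0#) → Series
  φ α β q nonzero k =
    poch α q k * inverse (nonzero k) * (- 1#) ^ k * q ^ (k ℕ.C 2)

  module StieltjesWigert (q : Carrier) (q-ind : IsIndeterminate q) where

    private

      open ≈-Reasoning setoid

      fromℤ-1 : fromℤ (+ 1) ≈ 1#
      fromℤ-1 = +-identityʳ 1#

      q#0 : q # 0#
      q#0 = #-congʳ eq (q-ind (+ 0 ∷ + 1 ∷ []) (there (here λ ())))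
        where
        eq : 0# + q * (fromℤ (+ 1) + q * 0#) ≈ q
        eq = begin
          0# + q * (fromℤ (+ 1) + q * 0#) ≈⟨ +-identityˡ _ ⟩
          q * (fromℤ (+ 1) + q * 0#)      ≈⟨ *-congˡ (+-cong fromℤ-1 (zeroʳ q)) ⟩
          q * (1# + 0#)                   ≈⟨ *-congˡ (+-identityʳ 1#) ⟩
          q * 1#                          ≈⟨ *-identityʳ q ⟩
          q                               ∎

      eval-power : ∀ m → q * eval (replicate m (+ 0) ++ [ -[1+ 0 ] ]) q ≈ - (q * q ^ m)
      eval-power zero = begin
        q * (- fromℤ (+ 1) + q * 0#) ≈⟨ *-congˡ (+-cong (-‿cong fromℤ-1) (zeroʳ q)) ⟩
        q * (- 1# + 0#)              ≈⟨ *-congˡ (+-identityʳ _) ⟩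
        q * - 1#                     ≈⟨ sym (-‿distribʳ-* q 1#) ⟩
        - (q * 1#)                   ∎
      eval-power (suc m) = begin
        q * (0# + q * e)       ≈⟨ *-congˡ (+-identityˡ _) ⟩
        q * (q * e)            ≈⟨ *-congˡ (eval-power m) ⟩
        q * - (q * q ^ m)      ≈⟨ sym (-‿distribʳ-* q _) ⟩
        - (q * (q * q ^ m))    ∎
        where e = eval (replicate m (+ 0) ++ [ -[1+ 0 ] ]) q

      1-qq^#0 : ∀ m → 1# - q * q ^ m # 0#
      1-qq^#0 m = #-congʳ (+-cong fromℤ-1 (eval-power m)) (q-ind (+ 1 ∷ replicate m (+ 0) ++ [ -[1+ 0 ] ]) (here λ ()))

      product#0 : ∀ k (f : Fin k → Carrier) → (∀ i → f i # 0#) → product f # 0#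
      product#0 zero    f f#0 = 1#0
      product#0 (suc k) f f#0 =
        x#0y#0→xy#0 (f#0 Fin.zero) (product#0 k (λ i → f (Fin.suc i)) λ i → f#0 (Fin.suc i))

      1-0#0 : ∀ x → 1# - 0# * x # 0#
      1-0#0 x = #-congʳ (sym (trans (+-congˡ (-‿cong (zeroˡ x))) (x-0≈x 1#))) 1#0

    denominator#0 : ∀ k → poch q q k * poch 0# q k # 0#
    denominator#0 k = x#0y#0→xy#0
      (product#0 k _ λ i → 1-qq^#0 (toℕ i))
      (product#0 k _ λ i → 1-0#0 (q ^ toℕ i))

    q⁻¹ : Carrier
    q⁻¹ = inverse q#0

    -- S_n(x;q).  The coefficient (q^{-n};q)_k vanishes for k > n.
    S : ℕ → Series
    S n = ((- 1#) ^ n * q⁻¹ ^ (n ℕ.* n)) •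
          dilate (- (q ^ suc n)) (φ (q⁻¹ ^ n) 0# q denominator#0)

    -- σ n k is only relevant for k ≤ n, where this equation determines it
    -- because S_k is monic of degree k.
    AreMixedMoments : (ℕ → ℕ → Carrier) → Set ℓ₁
    AreMixedMoments σ = ∀ n → X^ n ≋ Σ[k≤ n ] (λ k → σ n k • S k)

    weights : WeightSystem
    weights zero    i j _ = q⁻¹ ^ (i ℕ.+ j ℕ.+ 1)
    weights (suc t) i j _ = 0#

    weights-height : HasHeight weights 1
    weights-height = (λ { (suc t) i j j≤i _ → refl }) , least
      where
      least : ∀ ℓ → VanishesFrom weights ℓ → 1 ≤ ℓ
      least (suc ℓ) _ = s≤s z≤n
      least zero    van = contradiction 1#0 (#-irrefl 1≈0)
        where
        1≈0 : 1# ≈ 0#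
        1≈0 = begin
          1#            ≈⟨ sym (inverseˡ q#0) ⟩
          q⁻¹ * q       ≈⟨ *-congʳ (sym (*-identityʳ q⁻¹)) ⟩
          q⁻¹ ^ 1 * q   ≈⟨ *-congʳ (van 0 0 0 z≤n z≤n) ⟩
          0# * q        ≈⟨ zeroˡ q ⟩
          0#            ∎

{-# OPTIONS --safe #-}

-- Write p = 1/q.  Read backwards from (n,0), a path of nonzero weight stays at
-- level 0 until it leaves through some v^0_{k,k} and then climbs column k.  At
-- v^0_{d+j,j} with d > 0 it continues to v^0_{d+j,j+1} or, with weight
-- p^{d+2j+1}, to v^0_{d+j-1,j}; in both cases d drops by one, so the total
-- weights h_k(d,j) satisfy
--   h_k(0,j) = [j = k],  h_k(d+1,j) = h_k(d,j+1) + p^{d+2j+1} h_k(d,j).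
-- The identity S_{j+1}(x) + p^{2j+1} S_j(x) = p^j x S_j(qx) then gives, by
-- induction on d,
--   Σ_k h_k(d,j) S_k(x) = x^d p^{dj} S_j(q^d x),
-- which for d = n and j = 0 is x^n.  As S_k is monic of degree k, the
-- h_k(n,0) are the mixed moments.

module Submission where

open import Defs
open import Algebra.Apartness.Bundles using (HeytingField)
open import Algebra.Bundles using (CommutativeRing)
import Algebra.Properties.AbelianGroup
import Algebra.Properties.CommutativeSemiring.Exp as Exp
import Algebra.Properties.Monoid.Sum as MonoidSum
import Algebra.Properties.CommutativeMonoid.Sum as CommutativeMonoidSum
import Algebra.Properties.Ring as RingProperties
import Algebra.Properties.Semiring.Sum as SemiringSum
import Algebra.Solver.Ring.NaturalCoefficients.Default as Solver
open import Data.Fin.Base as Fin using (Fin; toℕ; fromℕ<)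
import Data.Fin.Properties as Fin
open import Data.List.Base using (List; []; _∷_; [_]; _++_; map; foldr)
import Data.List.Membership.Setoid as SetoidMembership
import Data.List.Relation.Unary.Any as Any
import Data.List.Relation.Unary.Any.Properties as Any
import Data.List.Relation.Unary.Unique.Setoid.Properties as UniqueSetoid
open import Data.Nat.Base as ℕ using (ℕ; zero; suc; _≤_; _<_; s≤s; z≤n)
import Data.Nat.Combinatorics as ℕ
import Data.Nat.Properties as ℕ
open import Data.Nat.Tactic.RingSolver using (solve-∀)
open import Data.Product.Base using (∃-syntax; _×_; _,_; proj₁; proj₂)
open import Data.Sum.Base using (_⊎_; inj₁; inj₂; [_,_]′)
import Relation.Binary.Reasoning.Setoid as ≈-Reasoning
open import Relation.Binary.PropositionalEquality as ≡ using (_≡_; _≢_)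
open import Relation.Nullary.Decidable using (yes; no; recompute)
open import Relation.Nullary.Negation using (¬_; contradiction)

module Paths where

  open import Data.Nat.Base
  open import Data.Nat.Properties
  open import Data.Integer.Base as ℤ using (+_)
  import Data.Integer.Properties as ℤ
  open import Data.List.Membership.Propositional using (_∈_)
  open import Data.List.Membership.Propositional.Properties
    using (∈-map⁺; ∈-map⁻; ∈-++⁺ˡ; ∈-++⁺ʳ)
  open import Data.List.Relation.Unary.All using ([])
  open import Data.List.Relation.Unary.AllPairs using ([]; _∷_)
  open import Data.List.Relation.Unary.Any using (here)
  open import Data.List.Relation.Unary.Unique.Propositional using (Unique)
  import Data.List.Relation.Unary.Unique.Propositional.Properties as Unique
  import Data.Rational.Unnormalised.Base as ℚᵘ
  open import Relation.Binary.PropositionalEquality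
    using (_≗_; refl; sym; trans; cong; cong₂; subst; subst₂)

  private variable
    k i j : ℕ
    u v : Vertex

  -- South steps and the infinite ascent of a column.

  ascend : Vertex → Vertex
  ascend (vertex t i j j≤i) with j <? i
  ... | yes j<i = vertex t i (suc j) j<i
  ... | no  _   = vertex (suc t) i 0 z≤n

  ascend-south : ∀ v → SouthStep (ascend v) v
  ascend-south (vertex t i j j≤i) with j <? i
  ... | yes j<i = within j<i
  -- The bound in a vertex is irrelevant, so it is recovered by decision; with `j≮i` it forces j =
  -- i.
  ... | no  j≮i with refl ← ≤-antisym (recompute (j ≤? i) j≤i) (≮⇒≥ j≮i) = across

  -- With `ascend-south`, exactly one south step ends at each vertex, so a path without east steps
  -- is determined by its end.
  south⇒ascend : SouthStep u v → u ≡ ascend v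
  south⇒ascend (within {t} {i} {j} j<i) with j <? i
  ... | yes _   = refl
  ... | no  j≮i = contradiction j<i j≮i
  south⇒ascend (across {t} {i}) with i <? i
  ... | yes i<i = contradiction i<i (<-irrefl refl)
  ... | no  _   = refl

  south-col : SouthStep u v → col u ≡ col v
  south-col (within _) = refl
  south-col across     = refl

  east-level : EastStep u v → level u ≡ level v
  east-level (east _) = refl

  east-col : EastStep u v → col v ≡ suc (col u)
  east-col (east _) = refl

  south-level : SouthStep u v → level v ≤ level u
  south-level (within _) = ≤-refl
  south-level across     = n≤1+n _

  -- height v = scaledHeight v / (col v + 1), and each south step lowers
  -- scaledHeight by exactly one.
  scaledHeight : Vertex → ℕ
  scaledHeight (vertex t i j _) = t * suc i + j

  south-scaledHeight : SouthStep u v → scaledHeight u ≡ suc (scaledHeight v)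
  south-scaledHeight (within {t} {i} {j} _) = +-suc (t * suc i) j
  south-scaledHeight (across {t} {i}) =
    trans (+-identityʳ _) (cong suc (+-comm i (t * suc i)))

  scaledHeight⇒height : ∀ B v → B * suc (col v) ≤ scaledHeight v →
                        (+ B ℚᵘ./ 1) ℚᵘ.≤ height v
  scaledHeight⇒height B (vertex t i j _) le =
    ℚᵘ.*≤* (subst₂ ℤ._≤_ lhs rhs (ℤ.+≤+ le))
    where
    -- Cross multiplication: `suc (i + 0)` is the product of the denominators 1 and i + 1 in
    -- `height`, and the trailing factor 1 in `rhs` is the denominator of B.
    lhs : + (B * suc i) ≡ + B ℤ.* + suc (i + 0)
    lhs = trans (cong (λ m → + (B * suc m)) (sym (+-identityʳ i))) (ℤ.pos-* B (suc (i + 0)))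
    rhs : + (t * suc i + j) ≡ (+ t ℤ.* + suc i ℤ.+ + j ℤ.* + 1) ℤ.* + 1
    rhs = sym (trans (ℤ.*-identityʳ _)
      (cong₂ ℤ._+_ (sym (ℤ.pos-* t (suc i))) (ℤ.*-identityʳ (+ j))))

  ascent : Vertex → ℕ → Vertex
  ascent v zero    = v
  ascent v (suc m) = ascend (ascent v m)

  ascent-col : ∀ v m → col (ascent v m) ≡ col v
  ascent-col v zero    = refl
  ascent-col v (suc m) = trans (south-col (ascend-south (ascent v m))) (ascent-col v m)

  -- An ascent keeps its column, so this growth is what makes it converge to (k,∞).
  m≤scaledHeight-ascent : ∀ v m → m ≤ scaledHeight (ascent v m)
  m≤scaledHeight-ascent v zero    = z≤n
  m≤scaledHeight-ascent v (suc m) =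
    ≤-trans (s≤s (m≤scaledHeight-ascent v m))
            (≤-reflexive (sym (south-scaledHeight (ascend-south (ascent v m)))))

  ascent-unique : (v : ℕ → Vertex) → (∀ m → SouthStep (v (suc m)) (v m)) →
                  v ≗ ascent (v 0)
  ascent-unique v souths zero    = refl
  ascent-unique v souths (suc m) =
    trans (south⇒ascend (souths m)) (cong ascend (ascent-unique v souths m))

  -- Words for the paths at level 0, and their enumeration.

  -- Word k i j: the paths to v^0_{i,j}, read backwards, that stay at level 0
  -- until they leave it for good from v^0_{k,k}.
  data Word (k : ℕ) : ℕ → ℕ → Set where
    exit : Word k k k
    up   : (j<i : j < i) → Word k i (suc j) → Word k i j
    left : (j≤i : j ≤ i) → Word k i j → Word k (suc i) j

  word-≤ : Word k i j → j ≤ i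
  word-≤ exit         = ≤-refl
  word-≤ (up j<i _)   = <⇒≤ j<i
  word-≤ (left j≤i _) = m≤n⇒m≤1+n j≤i

  -- The clause for index 0 does not split on the word, so the end of the path reduces to v^0_{i,j}
  -- for every `w`; `path` and `steps` rely on this. The price is that `vertices exit m` is stuck on
  -- `m`, hence `vertices-exit`.
  vertices : Word k i j → ℕ → Vertex
  vertices {i = i} {j} w zero    = vertex 0 i j (word-≤ w)
  vertices {k} exit      (suc m) = ascent (vertex 0 k k ≤-refl) (suc m)
  vertices (up _ w)      (suc m) = vertices w m
  vertices (left _ w)    (suc m) = vertices w m

  vertices-exit : ∀ m → vertices {k} exit m ≡ ascent (vertex 0 k k ≤-refl) m
  vertices-exit zero    = refl
  vertices-exit (suc m) = refl

  steps : (w : Word k i j) → ∀ m → Step (vertices w (suc m)) (vertices w m)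
  steps {k} exit     zero    = south (ascend-south (vertex 0 k k ≤-refl))
  steps {k} exit     (suc m) = south (ascend-south (ascent (vertex 0 k k ≤-refl) (suc m)))
  steps (up j<i w)   zero    = south (within j<i)
  steps (up j<i w)   (suc m) = steps w m
  steps (left j≤i w) zero    = east (east j≤i)
  steps (left j≤i w) (suc m) = steps w m

  size : Word k i j → ℕ
  size exit       = 0
  size (up _ w)   = suc (size w)
  size (left _ w) = suc (size w)

  -- Serves both limits in `path`: c = 0 for the column, c = B(k+1) for the height.
  vertices-tail : ∀ c (w : Word k i j) m → size w + c ≤ m →
                  col (vertices w m) ≡ k × c ≤ scaledHeight (vertices w m)
  vertices-tail {k} c exit m c≤m rewrite vertices-exit {k = k} m =
    ascent-col _ m , ≤-trans c≤m (m≤scaledHeight-ascent _ m)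
  vertices-tail c (up _ w)   (suc m) (s≤s le) = vertices-tail c w m le
  vertices-tail c (left _ w) (suc m) (s≤s le) = vertices-tail c w m le

  path : Word k i 0 → SE k i
  path {k} w = record
    { v          = vertices w
    ; v₀         = refl
    ; step       = steps w
    ; col-lim    = size w , λ m le →
        proj₁ (vertices-tail 0 w m (≤-trans (≤-reflexive (+-identityʳ _)) le))
    ; height-lim = λ B → size w + B * suc k , λ m le →
        let col≡k , high = vertices-tail (B * suc k) w m le in
        scaledHeight⇒height B (vertices w m)
          (subst (λ c → B * suc c ≤ scaledHeight (vertices w m)) (sym col≡k) high)
    }

  -- The vertex after v^0_{i,j} has position j+1 for `up` and j for `left`; where `exit` is
  -- possible, i = j rules out both.
  vertices-injective : (w w′ : Word k i j) → vertices w ≗ vertices w′ → w ≡ w′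
  vertices-injective {k} exit exit eq = refl
  vertices-injective {k} exit (up k<k _) eq = contradiction k<k (<-irrefl refl)
  vertices-injective {k} exit (left k<k _) eq = contradiction k<k (<-irrefl refl)
  vertices-injective (up k<k _) exit eq = contradiction k<k (<-irrefl refl)
  vertices-injective (up p w) (up p′ w′) eq =
    cong₂ up (<-irrelevant p p′) (vertices-injective w w′ (λ m → eq (suc m)))
  vertices-injective (up _ w) (left _ w′) eq =
    contradiction (cong pos (eq 1)) 1+n≢n
  vertices-injective (left k<k _) exit eq = contradiction k<k (<-irrefl refl)
  vertices-injective (left _ w) (up _ w′) eq =
    contradiction (cong pos (eq 1)) (λ e → 1+n≢n (sym e))
  vertices-injective (left p w) (left p′ w′) eq =
    cong₂ left (≤-irrelevant p p′) (vertices-injective w w′ (λ m → eq (suc m)))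

  -- Either move lowers d = i - j by one, so the recursion is on d. The equation is an argument
  -- because `up` leads to position j+1, where suc d + j has to be read as d + suc j.
  words : ∀ k d i j → i ≡ d + j → List (Word k i j)
  words k zero i j refl with j ≟ k
  ... | yes refl = [ exit ]
  ... | no  _    = []
  words k (suc d) i j refl =
    map (up (s≤s (m≤n+m j d))) (words k d _ (suc j) (sym (+-suc d j))) ++
    map (left (m≤n+m j d)) (words k d (d + j) j refl)

  -- The bounds stored in `up` and `left` have only one proof each, so they agree with those chosen
  -- by `words`.
  words-complete : ∀ d (eq : i ≡ d + j) (w : Word k i j) → w ∈ words k d i j eq
  words-complete {k = k} zero refl exit with k ≟ k
  ... | yes refl = here refl
  ... | no  k≢k  = contradiction refl k≢k
  words-complete zero refl (up j<j _)     = contradiction j<j (<-irrefl refl)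
  words-complete zero refl (left 1+i≤i _) = contradiction 1+i≤i (<-irrefl refl)
  words-complete {j = j} (suc d) eq exit =
    contradiction (≤-trans (s≤s (m≤n+m j d)) (≤-reflexive (sym eq))) (<-irrefl refl)
  words-complete {j = j} (suc d) refl (up p w)
    rewrite <-irrelevant p (s≤s (m≤n+m j d)) =
    ∈-++⁺ˡ (∈-map⁺ _ (words-complete d (sym (+-suc d j)) w))
  words-complete {j = j} (suc d) refl (left p w)
    rewrite ≤-irrelevant p (m≤n+m j d) =
    ∈-++⁺ʳ _ (∈-map⁺ _ (words-complete d refl w))

  words-unique : ∀ k d i j (eq : i ≡ d + j) → Unique (words k d i j eq)
  words-unique k zero i j refl with j ≟ k
  ... | yes refl = [] ∷ []
  ... | no  _    = []
  words-unique k (suc d) i j refl = Unique.++⁺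
    (Unique.map⁺ (λ { refl → refl }) (words-unique k d _ (suc j) _))
    (Unique.map⁺ (λ { refl → refl }) (words-unique k d _ j _))
    λ (∈ups , ∈lefts) → up≢left (proj₂ (proj₂ (∈-map⁻ _ ∈ups))) (proj₂ (proj₂ (∈-map⁻ _ ∈lefts)))
    where
    up≢left : ∀ {k i j} {w : Word k (suc i) j} {p x p′ y} → w ≡ up p x → w ≢ left p′ y
    up≢left refl ()

  -- Decoding a path into its word.

  -- The steps available to a path of nonzero weight, since the weight system has height 1.
  LowStep : Vertex → Vertex → Set
  LowStep u v = SouthStep u v ⊎ EastStep u v × level v ≡ 0

  low-level : LowStep u v → level v ≤ level u
  low-level (inj₁ s)       = south-level s
  low-level (inj₂ (_ , 0≡)) = ≤-trans (≤-reflexive 0≡) z≤n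

  -- Read backwards, a path never loses level, so after leaving level 0 it meets no further low east
  -- step.
  high⇒south : (v : ℕ → Vertex) → (∀ m → LowStep (v (suc m)) (v m)) →
               0 < level (v 0) → ∀ m → SouthStep (v (suc m)) (v m)
  high⇒south v low 0<l m with low m
  ... | inj₁ s         = s
  ... | inj₂ (_ , 0≡) = contradiction (≤-trans (high m) (≤-reflexive 0≡)) λ ()
    where
    high : ∀ m → 0 < level (v m)
    high zero    = 0<l
    high (suc m) = ≤-trans (high m) (low-level (low m))

  -- The cases carry equations instead of indices because the vertices of a given path are values of
  -- a function, not variables to match on.
  data Predecessor (i j : ℕ) (u : Vertex) : Set where
    above   : (j<i : j < i) → u ≡ vertex 0 i (suc j) j<i → Predecessor i j u
    leftOf  : ∀ {i′} (j≤i′ : j ≤ i′) → i ≡ suc i′ → u ≡ vertex 0 i′ j j≤i′ → Predecessor i j u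
    outside : i ≡ j → u ≡ vertex 1 i 0 z≤n → Predecessor i j u

  predecessor : ∀ {u v} .{j≤i : j ≤ i} → LowStep u v → v ≡ vertex 0 i j j≤i → Predecessor i j u
  predecessor (inj₁ (within j<i)) refl = above j<i refl
  predecessor (inj₁ across) refl = outside refl refl
  predecessor (inj₂ (east j≤i , _)) refl = leftOf (recompute (_ ≤? _) j≤i) refl refl

  -- Induction on d, which drops with each step inside level 0. Once level 1 is entered all steps
  -- are south, the column stays i, and the limit of the columns gives i = k, hence `exit`.
  parse : ∀ d → i ≡ d + j → (v : ℕ → Vertex) .{j≤i : j ≤ i} → v 0 ≡ vertex 0 i j j≤i →
          (∀ m → LowStep (v (suc m)) (v m)) →
          (∃[ N ] ∀ m → N ≤ m → col (v m) ≡ k) →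
          ∃[ w ] v ≗ vertices {k} {i} {j} w
  parse {i} {j} {k} d eq v v₀ low (N , lim) with predecessor (low 0) v₀
  parse {i} {j} {k} d eq v v₀ low (N , lim) | outside refl v₁ = result
    where
    south-all : ∀ m → SouthStep (v (suc m)) (v m)
    south-all zero with low 0
    ... | inj₁ s = s
    -- An east step keeps the level, whereas this one would join level 1 to level 0.
    ... | inj₂ (e , _) = contradiction
      (trans (sym (cong level v₁)) (trans (east-level e) (cong level v₀))) λ ()
    south-all (suc m) = high⇒south (λ m → v (suc m)) (λ m → low (suc m))
      (≤-reflexive (sym (cong level v₁))) m
    ascends : ∀ m → v m ≡ ascent (vertex 0 i i ≤-refl) m
    ascends m = trans (ascent-unique v south-all m) (cong (λ u → ascent u m) v₀)
    i≡k : i ≡ k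
    i≡k = trans (sym (trans (cong col (ascends N)) (ascent-col _ N))) (lim N ≤-refl)
    result : ∃[ w ] v ≗ vertices {k} {i} {i} w
    result with refl ← i≡k = exit , λ m → trans (ascends m) (sym (vertices-exit m))
  parse zero refl v v₀ low lim | above j<j _ = contradiction j<j (<-irrefl refl)
  parse (suc d) refl v v₀ low (N , lim) | above j<i v₁ =
    let w , eq = parse d (sym (+-suc d _)) (λ m → v (suc m)) v₁ (λ m → low (suc m))
                   (N , λ m N≤m → lim (suc m) (m≤n⇒m≤1+n N≤m))
    in up j<i w , λ { zero → v₀ ; (suc m) → eq m }
  parse zero refl v v₀ low lim | leftOf j≤i′ refl _ = contradiction j≤i′ (<-irrefl refl)
  parse (suc d) refl v v₀ low (N , lim) | leftOf j≤i′ refl v₁ =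
    let w , eq = parse d refl (λ m → v (suc m)) v₁ (λ m → low (suc m))
                   (N , λ m N≤m → lim (suc m) (m≤n⇒m≤1+n N≤m))
    in left j≤i′ w , λ { zero → v₀ ; (suc m) → eq m }

open Paths

module Moments {a ℓ₁ ℓ₂} (K : HeytingField a ℓ₁ ℓ₂)
         (q : HeytingField.Carrier K) (q-ind : OverField.IsIndeterminate K q) where

  open OverField K
  open StieltjesWigert q q-ind
  open CommutativeRing commutativeRing
  open Exp commutativeSemiring using (^-homo-*; ^-distrib-*; ^-congʳ; ^-congˡ)
  open RingProperties ring using (-1*x≈-x; +-cancelʳ)
  open ≈-Reasoning setoid
  open Solver commutativeSemiring using (solve; _:=_; _:+_; _:*_; con)
  module Product = MonoidSum *-monoid
  open SemiringSum semiring using (*-distribˡ-sum)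
  open CommutativeMonoidSum +-commutativeMonoid
    using (sum-cong-≋; ∑-distrib-+; sum-init-last; sum-replicate-zero)

  -- Arithmetic with p = 1/q and finite products.

  p : Carrier
  p = q⁻¹

  -- Negation is written as multiplication by ε, since the solver is one for
  -- semirings.
  ε : Carrier
  ε = - 1#

  pq≈1 : p * q ≈ 1#
  pq≈1 = inverseˡ _

  1^n≈1 : ∀ n → 1# ^ n ≈ 1#
  1^n≈1 zero    = refl
  1^n≈1 (suc n) = trans (*-identityˡ _) (1^n≈1 n)

  pⁿqⁿ≈1 : ∀ n → p ^ n * q ^ n ≈ 1#
  pⁿqⁿ≈1 n = trans (sym (^-distrib-* p q n)) (trans (^-congˡ n pq≈1) (1^n≈1 n))

  ε*ε≈1 : ε * ε ≈ 1#
  ε*ε≈1 = trans (-1*x≈-x ε) (-‿involutive 1#)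
    where open Algebra.Properties.AbelianGroup +-abelianGroup renaming (⁻¹-involutive to -‿involutive)

  1-x≈1+εx : ∀ x → 1# - x ≈ 1# + ε * x
  1-x≈1+εx x = +-congˡ (sym (-1*x≈-x x))

  x+εx≈0 : ∀ x → x + ε * x ≈ 0#
  x+εx≈0 x = trans (+-congˡ (-1*x≈-x x)) (-‿inverseʳ x)

  product-zero : ∀ {n} (f : Fin n → Carrier) i → f i ≈ 0# → product f ≈ 0#
  product-zero f Fin.zero    f₀≈0 = trans (*-congʳ f₀≈0) (zeroˡ _)
  product-zero f (Fin.suc i) fᵢ≈0 =
    trans (*-congˡ (product-zero (λ i → f (Fin.suc i)) i fᵢ≈0)) (zeroʳ _)

  product-snoc : ∀ n (f : ℕ → Carrier) →
    product {suc n} (λ i → f (toℕ i)) ≈ product {n} (λ i → f (toℕ i)) * f n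
  product-snoc n f = trans (Product.sum-init-last (λ i → f (toℕ i)))
    (*-cong (reflexive (Product.sum-cong-≗ {n} λ i → ≡.cong f (Fin.toℕ-inject₁ i)))
            (reflexive (≡.cong f (Fin.toℕ-fromℕ n))))

  sum-snoc : ∀ n (f : ℕ → Carrier) →
    sum {suc n} (λ i → f (toℕ i)) ≈ sum {n} (λ i → f (toℕ i)) + f n
  sum-snoc n f = trans (sum-init-last (λ i → f (toℕ i)))
    (+-cong (sum-cong-≋ {n} λ i → reflexive (≡.cong f (Fin.toℕ-inject₁ i)))
            (reflexive (≡.cong f (Fin.toℕ-fromℕ n))))

  -- Factors of the q-shifted factorials and of the denominators.

  poch-snoc : ∀ z k → poch z q (suc k) ≈ poch z q k * (1# - z * q ^ k)
  poch-snoc z k = product-snoc k (λ i → 1# - z * q ^ i)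

  -- The first factor splits off; in the others p^{n+1} q^{i+1} = p^n q^i.
  poch-shift : ∀ n k → poch (p ^ suc n) q (suc k) ≈ (1# - p * p ^ n) * poch (p ^ n) q k
  poch-shift n k = *-cong
    (+-congˡ (-‿cong (*-identityʳ _)))
    (Product.sum-cong-≋ {k} λ i → +-congˡ (-‿cong (begin
      (p * p ^ n) * (q * q ^ toℕ i)
        ≈⟨ solve 4 (λ p P q Q → (p :* P) :* (q :* Q) := (p :* q) :* (P :* Q)) refl p (p ^ n) q (q ^ toℕ i) ⟩
      (p * q) * (p ^ n * q ^ toℕ i) ≈⟨ *-congʳ pq≈1 ⟩
      1# * (p ^ n * q ^ toℕ i)      ≈⟨ *-identityˡ _ ⟩
      p ^ n * q ^ toℕ i             ∎)))

  1/D : ℕ → Carrier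
  1/D k = inverse (denominator#0 k)

  -- Every factor of (0;q)_{k+1} is 1, so only (q;q)_{k+1} contributes a new factor.
  D-snoc : ∀ k → poch q q (suc k) * poch 0# q (suc k) ≈
                 (poch q q k * poch 0# q k) * (1# - q * q ^ k)
  D-snoc k = begin
    poch q q (suc k) * poch 0# q (suc k)
      ≈⟨ *-cong (poch-snoc q k) (poch-snoc 0# k) ⟩
    (poch q q k * r) * (poch 0# q k * (1# - 0# * q ^ k))
      ≈⟨ *-congˡ (*-congˡ (trans (1-x≈1+εx _) (trans (+-congˡ (trans (*-congˡ (zeroˡ _)) (zeroʳ _))) (+-identityʳ 1#)))) ⟩
    (poch q q k * r) * (poch 0# q k * 1#)
      ≈⟨ solve 3 (λ a r b → (a :* r) :* (b :* con 1) := (a :* b) :* r) refl (poch q q k) r (poch 0# q k) ⟩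
    (poch q q k * poch 0# q k) * r ∎
    where r = 1# - q * q ^ k

  -- Insert `1/D (suc k)` times its denominator, split the latter by `D-snoc`, and cancel the
  -- denominator of index k.
  1/D-suc : ∀ k → 1/D k ≈ 1/D (suc k) * (1# - q * q ^ k)
  1/D-suc k = begin
    1/D k                  ≈⟨ sym (*-identityˡ _) ⟩
    1# * 1/D k             ≈⟨ *-congʳ (sym (inverseˡ (denominator#0 (suc k)))) ⟩
    (i′ * D′) * 1/D k      ≈⟨ *-congʳ (*-congˡ (D-snoc k)) ⟩
    (i′ * (D * r)) * 1/D k
      ≈⟨ solve 4 (λ i D r e → (i :* (D :* r)) :* e := (i :* r) :* (e :* D)) refl i′ D r (1/D k) ⟩
    (i′ * r) * (1/D k * D) ≈⟨ *-congˡ (inverseˡ (denominator#0 k)) ⟩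
    (i′ * r) * 1#          ≈⟨ *-identityʳ _ ⟩
    i′ * r                 ∎
    where
    i′ = 1/D (suc k)
    r = 1# - q * q ^ k
    D = poch q q k * poch 0# q k
    D′ = poch q q (suc k) * poch 0# q (suc k)

  -- The recurrence of the Stieltjes-Wigert polynomials.

  p^[2j+1] : ∀ j → p ^ (j ℕ.+ j ℕ.+ 1) ≈ p * (p ^ j * p ^ j)
  p^[2j+1] j = trans (^-congʳ p (ℕ.+-comm (j ℕ.+ j) 1)) (*-congˡ (^-homo-* p j j))

  p^[1+j]² : ∀ j → p ^ (suc j ℕ.* suc j) ≈ p ^ (j ℕ.* j) * p ^ (j ℕ.+ j ℕ.+ 1)
  p^[1+j]² j = trans (^-congʳ p (eq j)) (^-homo-* p (j ℕ.* j) _)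
    where
    eq : ∀ j → suc j ℕ.* suc j ≡ j ℕ.* j ℕ.+ (j ℕ.+ j ℕ.+ 1)
    eq = solve-∀

  q^[1+m]C2 : ∀ m → q ^ (suc m ℕ.C 2) ≈ q ^ (m ℕ.C 2) * q ^ m
  q^[1+m]C2 m = trans (^-congʳ q eq) (^-homo-* q (m ℕ.C 2) m)
    where
    eq : suc m ℕ.C 2 ≡ m ℕ.C 2 ℕ.+ m
    eq = ≡.trans (≡.sym (ℕ.nCk+nC[k+1]≡[n+1]C[k+1] m 1))
      (≡.trans (≡.cong (ℕ._+ m ℕ.C 2) (ℕ.nC1≡n m)) (ℕ.+-comm m _))

  -- S-recurrence-zero and S-recurrence-suc are the coefficients of
  -- S_{j+1}(x) + q^{-2j-1} S_j(x) = q^{-j} x S_j(q x).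
  S-recurrence-zero : ∀ j → S (suc j) 0 + p ^ (j ℕ.+ j ℕ.+ 1) * S j 0 ≈ 0#
  S-recurrence-zero j = begin
    (ε * E) * p ^ (suc j ℕ.* suc j) * Z + c * ((E * s) * Z)
      ≈⟨ +-congʳ (*-congʳ (*-congˡ (p^[1+j]² j))) ⟩
    (ε * E) * (s * c) * Z + c * ((E * s) * Z)
      ≈⟨ solve 5 (λ ε E s c Z → (ε :* E) :* (s :* c) :* Z :+ c :* ((E :* s) :* Z) :=
                   c :* ((E :* s) :* Z) :+ ε :* (c :* ((E :* s) :* Z))) refl ε E s c Z ⟩
    c * ((E * s) * Z) + ε * (c * ((E * s) * Z)) ≈⟨ x+εx≈0 _ ⟩
    0# ∎
    where
    E = ε ^ j
    s = p ^ (j ℕ.* j)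
    c = p ^ (j ℕ.+ j ℕ.+ 1)
    Z = 1# * (1# * 1/D 0 * 1# * q ^ (0 ℕ.C 2))

  -- The bracket left in `S-recurrence-suc` after taking out common factors, with u = q^{m+1}, v =
  -- p^{j+1}, x = p^j q^m. Its value 1 - q^{m+1} is the factor that `1/D-suc` absorbs.
  factor-identity : ∀ u v x → u * v ≈ x →
    ε * u * (1# - v) + (1# - x) ≈ 1# - u
  factor-identity u v x uv≈x = begin
    ε * u * (1# - v) + (1# - x)
      ≈⟨ +-cong (*-congˡ (1-x≈1+εx v)) (trans (1-x≈1+εx x) (+-congˡ (*-congˡ (sym uv≈x)))) ⟩
    ε * u * (1# + ε * v) + (1# + ε * (u * v))
      ≈⟨ solve 3 (λ ε u v → ε :* u :* (con 1 :+ ε :* v) :+ (con 1 :+ ε :* (u :* v)) :=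
            (con 1 :+ ε :* u) :+ (ε :* (u :* v) :+ ε :* (ε :* (u :* v)))) refl ε u v ⟩
    (1# + ε * u) + (ε * (u * v) + ε * (ε * (u * v))) ≈⟨ +-cong (sym (1-x≈1+εx u)) (x+εx≈0 _) ⟩
    (1# - u) + 0# ≈⟨ +-identityʳ _ ⟩
    1# - u ∎

  S-recurrence-suc : ∀ j m →
    S (suc j) (suc m) + p ^ (j ℕ.+ j ℕ.+ 1) * S j (suc m) ≈ p ^ j * (q ^ m * S j m)
  S-recurrence-suc j m = begin
    S (suc j) (suc m) + p ^ (j ℕ.+ j ℕ.+ 1) * S j (suc m)
      -- (p^{j+1};q)_{m+1} gives up its first factor `α` and (p^j;q)_{m+1} its last factor `β`, so
      -- both terms contain (p^j;q)_m; the dilation factors satisfy y′ = q y.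
      ≈⟨ +-cong
          (*-cong (*-congˡ (trans (p^[1+j]² j) (*-congˡ c≈)))
            (*-cong (*-cong y′≈ (trans (^-congˡ m y′≈qy) (^-distrib-* q y m)))
              (*-cong (*-congʳ (*-congʳ (poch-shift j m))) (q^[1+m]C2 m))))
          (*-cong c≈ (*-congˡ
            (*-cong (*-congʳ y≈) (*-cong (*-congʳ (*-congʳ (poch-snoc P m))) (q^[1+m]C2 m))))) ⟩
    ((ε * E) * (s * (p * (P * P)))) *
      ((ε * (q * (q * Q)) * (B * Y)) * (((α * A) * I′) * (ε * e) * (C * B)))
    + (p * (P * P)) * ((E * s) * ((ε * (q * Q) * Y) * (((A * β) * I′) * (ε * e) * (C * B))))
      ≈⟨ solve 15 (λ ε E s p P q Q B Y α A I e C β →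
           ((ε :* E) :* (s :* (p :* (P :* P)))) :*
             ((ε :* (q :* (q :* Q)) :* (B :* Y)) :* (((α :* A) :* I) :* (ε :* e) :* (C :* B)))
           :+ (p :* (P :* P)) :* ((E :* s) :* ((ε :* (q :* Q) :* Y) :* (((A :* β) :* I) :* (ε :* e) :* (C :* B))))
           := (ε :* ε) :* ((p :* q) :* (P :* Q)) :*
              ((P :* B :* (E :* s :* Y :* A :* I :* e :* C)) :* (ε :* (q :* B) :* α :+ β)))
           refl ε E s p P q Q B Y α A I′ e C β ⟩
    (ε * ε) * ((p * q) * (P * Q)) * ((P * B * F) * (ε * (q * B) * α + β))
      ≈⟨ *-cong (*-cong ε*ε≈1 (*-cong pq≈1 (pⁿqⁿ≈1 j)))
                (*-congˡ (factor-identity (q * B) (p * P) (P * B) uv≈x)) ⟩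
    1# * (1# * 1#) * ((P * B * F) * γ)
      ≈⟨ solve 10 (λ P B E s Y A I e C γ →
           con 1 :* (con 1 :* con 1) :* ((P :* B :* (E :* s :* Y :* A :* I :* e :* C)) :* γ) :=
           P :* (B :* ((E :* s) :* (Y :* ((A :* (I :* γ)) :* e :* C)))))
           refl P B E s Y A I′ e C γ ⟩
    P * (B * ((E * s) * (Y * ((A * (I′ * γ)) * e * C))))
      ≈⟨ *-congˡ (*-congˡ (*-congˡ (*-congˡ (*-congʳ (*-congʳ (*-congˡ (sym (1/D-suc m)))))))) ⟩
    P * (B * S j m) ∎
    where
    E = ε ^ j
    s = p ^ (j ℕ.* j)
    P = p ^ j
    Q = q ^ j
    B = q ^ m
    y = - (q ^ suc j)
    Y = y ^ m
    A = poch P q m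
    I′ = 1/D (suc m)
    e = ε ^ m
    C = q ^ (m ℕ.C 2)
    α = 1# - p * P
    β = 1# - P * B
    γ = 1# - q * B
    F = E * s * Y * A * I′ * e * C
    c≈ : p ^ (j ℕ.+ j ℕ.+ 1) ≈ p * (P * P)
    c≈ = p^[2j+1] j
    y≈ : y ≈ ε * (q * Q)
    y≈ = sym (-1*x≈-x _)
    y′≈ : - (q ^ suc (suc j)) ≈ ε * (q * (q * Q))
    y′≈ = sym (-1*x≈-x _)
    y′≈qy : - (q ^ suc (suc j)) ≈ q * y
    y′≈qy = RingProperties.-‿distribʳ-* ring q (q * Q)
    uv≈x : (q * B) * (p * P) ≈ P * B
    uv≈x = begin
      (q * B) * (p * P) ≈⟨ solve 4 (λ q B p P → (q :* B) :* (p :* P) := (p :* q) :* (P :* B)) refl q B p P ⟩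
      (p * q) * (P * B) ≈⟨ *-congʳ pq≈1 ⟩
      1# * (P * B)      ≈⟨ *-identityˡ _ ⟩
      P * B             ∎

  -- Degree, leading coefficient and uniqueness of expansions.

  S₀-monic : S 0 0 ≈ 1#
  S₀-monic = begin
    (1# * 1#) * (1# * (1# * 1/D 0 * 1# * 1#))
      ≈⟨ solve 1 (λ i → (con 1 :* con 1) :* (con 1 :* (con 1 :* i :* con 1 :* con 1)) := i :* (con 1 :* con 1)) refl (1/D 0) ⟩
    1/D 0 * (1# * 1#) ≈⟨ inverseˡ (denominator#0 0) ⟩
    1# ∎

  -- The first factor of (1;q)_{m+1} is 1 - 1.
  S₀-upper : ∀ m → S 0 (suc m) ≈ 0#
  S₀-upper m = trans (*-congˡ (*-congˡ (*-congʳ (*-congʳ (*-congʳ poch≈0)))))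
    (solve 5 (λ a b c d e → a :* (b :* (con 0 :* c :* d :* e)) := con 0) refl _ _ _ _ _)
    where
    poch≈0 : poch (p ^ 0) q (suc m) ≈ 0#
    poch≈0 = product-zero {suc m} (λ i → 1# - p ^ 0 * q ^ toℕ i) Fin.zero
      (trans (+-congˡ (-‿cong (*-identityˡ 1#))) (-‿inverseʳ 1#))

  -- Induction on j: in `S-recurrence-suc` both coefficients of S_j lie above its degree.
  S-upper : ∀ j m → j < m → S j m ≈ 0#
  S-upper zero    (suc m) _         = S₀-upper m
  S-upper (suc j) (suc m) (s≤s j<m) = begin
    S (suc j) (suc m) ≈⟨ sym (trans (+-congˡ (trans (*-congˡ (S-upper j (suc m) (ℕ.m≤n⇒m≤1+n j<m))) (zeroʳ _))) (+-identityʳ _)) ⟩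
    S (suc j) (suc m) + p ^ (j ℕ.+ j ℕ.+ 1) * S j (suc m) ≈⟨ S-recurrence-suc j m ⟩
    p ^ j * (q ^ m * S j m) ≈⟨ *-congˡ (trans (*-congˡ (S-upper j m j<m)) (zeroʳ _)) ⟩
    p ^ j * 0# ≈⟨ zeroʳ _ ⟩
    0# ∎

  -- In the recurrence at m = j the term `S j (suc j)` vanishes, and p^j q^j = 1.
  S-monic : ∀ j → S j j ≈ 1#
  S-monic zero    = S₀-monic
  S-monic (suc j) = begin
    S (suc j) (suc j) ≈⟨ sym (trans (+-congˡ (trans (*-congˡ (S-upper j (suc j) (ℕ.n<1+n j))) (zeroʳ _))) (+-identityʳ _)) ⟩
    S (suc j) (suc j) + p ^ (j ℕ.+ j ℕ.+ 1) * S j (suc j) ≈⟨ S-recurrence-suc j j ⟩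
    p ^ j * (q ^ j * S j j) ≈⟨ *-congˡ (trans (*-congˡ (S-monic j)) (*-identityʳ _)) ⟩
    p ^ j * q ^ j           ≈⟨ pⁿqⁿ≈1 j ⟩
    1# ∎

  -- Among S_0, ..., S_n only S_n has a term in x^n, so the top coefficients agree; cancel them and
  -- descend.
  coefficients-unique : ∀ n (f g : ℕ → Carrier) →
    Σ[k≤ n ] (λ k → f k • S k) ≋ Σ[k≤ n ] (λ k → g k • S k) → ∀ k → k ≤ n → f k ≈ g k
  coefficients-unique n f g eq k k≤n = go (suc n) eq k (s≤s k≤n)
    where
    Σ< : ℕ → (ℕ → Carrier) → Series
    Σ< n f m = sum {n} (λ k → f (toℕ k) * S (toℕ k) m)

    Σ<-upper : ∀ n f m → n ≤ m → Σ< n f m ≈ 0#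
    Σ<-upper n f m n≤m = trans
      (sum-cong-≋ {n} λ k → trans (*-congˡ (S-upper (toℕ k) m (ℕ.<-≤-trans (Fin.toℕ<n k) n≤m))) (zeroʳ _))
      (sum-replicate-zero n)

    leading : ∀ n f → Σ< (suc n) f n ≈ f n
    leading n f = begin
      Σ< (suc n) f n            ≈⟨ sum-snoc n (λ k → f k * S k n) ⟩
      Σ< n f n + f n * S n n    ≈⟨ +-cong (Σ<-upper n f n ℕ.≤-refl) (*-congˡ (S-monic n)) ⟩
      0# + f n * 1#             ≈⟨ trans (+-identityˡ _) (*-identityʳ _) ⟩
      f n                       ∎

    go : ∀ n → Σ< n f ≋ Σ< n g → ∀ k → k < n → f k ≈ g k
    go (suc n) eq k (s≤s k≤n) = [ go n eq′ k , (λ { ≡.refl → fₙ≈gₙ }) ]′ (ℕ.m≤n⇒m<n∨m≡n k≤n)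
      where
      fₙ≈gₙ : f n ≈ g n
      fₙ≈gₙ = trans (sym (leading n f)) (trans (eq n) (leading n g))
      eq′ : Σ< n f ≋ Σ< n g
      eq′ m = +-cancelʳ (f n * S n m) _ _ (begin
        Σ< n f m + f n * S n m ≈⟨ sym (sum-snoc n (λ k → f k * S k m)) ⟩
        Σ< (suc n) f m         ≈⟨ eq m ⟩
        Σ< (suc n) g m         ≈⟨ sum-snoc n (λ k → g k * S k m) ⟩
        Σ< n g m + g n * S n m ≈⟨ +-congˡ (*-congʳ (sym fₙ≈gₙ)) ⟩
        Σ< n g m + f n * S n m ∎)

  -- The generating function of the path sums.

  -- Multiplication by x^d.
  shift : ℕ → Series → Series
  shift zero    f m       = f m
  shift (suc d) f zero    = 0#
  shift (suc d) f (suc m) = shift d f m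

  shift-cong : ∀ d {f g} → f ≋ g → shift d f ≋ shift d g
  shift-cong zero    f≋g m       = f≋g m
  shift-cong (suc d) f≋g zero    = refl
  shift-cong (suc d) f≋g (suc m) = shift-cong d f≋g m

  -- The two hypotheses say f + c g = x h coefficientwise; multiply by x^d.
  shift-step : ∀ d {f g h c} → f 0 + c * g 0 ≈ 0# →
    (∀ m → f (suc m) + c * g (suc m) ≈ h m) →
    ∀ m → shift d f m + c * shift d g m ≈ shift (suc d) h m
  shift-step zero    eq₀ eqₛ zero    = eq₀
  shift-step zero    eq₀ eqₛ (suc m) = eqₛ m
  shift-step (suc d) eq₀ eqₛ zero    = trans (+-identityˡ _) (zeroʳ _)
  shift-step (suc d) eq₀ eqₛ (suc m) = shift-step d eq₀ eqₛ m

  shift-S₀ : ∀ n → shift n (S 0) ≋ X^ n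
  shift-S₀ zero    zero    = S₀-monic
  shift-S₀ zero    (suc m) = S₀-upper m
  shift-S₀ (suc n) zero    = refl
  shift-S₀ (suc n) (suc m) = shift-S₀ n m

  -- The coefficients of x^j double as the Kronecker delta that starts `pathSum`.
  X^-diagonal : ∀ j → (X^ j) j ≈ 1#
  X^-diagonal zero    = refl
  X^-diagonal (suc j) = X^-diagonal j

  X^-off-diagonal : ∀ j k → j ≢ k → (X^ j) k ≈ 0#
  X^-off-diagonal zero    zero    j≢k = contradiction ≡.refl j≢k
  X^-off-diagonal zero    (suc k) j≢k = refl
  X^-off-diagonal (suc j) zero    j≢k = refl
  X^-off-diagonal (suc j) (suc k) j≢k = X^-off-diagonal j k λ j≡k → j≢k (≡.cong suc j≡k)

  sum-X^ : ∀ n j → j < n → (f : ℕ → Carrier) →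
    sum {n} (λ k → (X^ j) (toℕ k) * f (toℕ k)) ≈ f j
  sum-X^ (suc n) zero    _         f = trans
    (+-cong (*-identityˡ _) (trans (sum-cong-≋ {n} λ k → zeroˡ _) (sum-replicate-zero n)))
    (+-identityʳ _)
  sum-X^ (suc n) (suc j) (s≤s j<n) f =
    trans (+-cong (zeroˡ _) (sum-X^ n j j<n (λ k → f (suc k)))) (+-identityˡ _)

  -- pathSum k d j is the total weight of the paths from (k,∞) to v^0_{d+j,j}.
  pathSum : ℕ → ℕ → ℕ → Carrier
  pathSum k zero    j = (X^ j) k
  pathSum k (suc d) j = pathSum k d (suc j) + p ^ (d ℕ.+ j ℕ.+ j ℕ.+ 1) * pathSum k d j

  -- x^d q^{-dj} S_j(q^d x)
  shiftedS : ℕ → ℕ → Series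
  shiftedS d j = shift d (λ m → p ^ (d ℕ.* j) * ((q ^ d) ^ m * S j m))

  -- The recurrence of S_j at q^d x, multiplied by x^d p^{d(j+1)}; the exponents match because
  -- d(j+1) + 2j+1 = dj + (d+2j+1).
  shiftedS-step : ∀ d j m →
    shiftedS d (suc j) m + p ^ (d ℕ.+ j ℕ.+ j ℕ.+ 1) * shiftedS d j m ≈ shiftedS (suc d) j m
  shiftedS-step d j = shift-step d eq₀ eqₛ
    where
    c = p ^ (d ℕ.+ j ℕ.+ j ℕ.+ 1)
    c′ = p ^ (j ℕ.+ j ℕ.+ 1)
    pd = p ^ d
    pdj = p ^ (d ℕ.* j)
    qd = q ^ d

    c≈ : c ≈ pd * c′
    c≈ = trans (^-congʳ p (eq d j)) (^-homo-* p d _)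
      where
      eq : ∀ d j → d ℕ.+ j ℕ.+ j ℕ.+ 1 ≡ d ℕ.+ (j ℕ.+ j ℕ.+ 1)
      eq = solve-∀

    pd[1+j]≈ : p ^ (d ℕ.* suc j) ≈ pd * pdj
    pd[1+j]≈ = trans (^-congʳ p (ℕ.*-suc d j)) (^-homo-* p d _)

    combine : ∀ m → p ^ (d ℕ.* suc j) * (qd ^ m * S (suc j) m) + c * (pdj * (qd ^ m * S j m))
              ≈ pd * pdj * (qd ^ m * (S (suc j) m + c′ * S j m))
    combine m = trans (+-cong (*-congʳ pd[1+j]≈) (*-congʳ c≈))
      (solve 6 (λ pd pdj Q s c t → pd :* pdj :* (Q :* s) :+ pd :* c :* (pdj :* (Q :* t)) :=
                 pd :* pdj :* (Q :* (s :+ c :* t))) refl pd pdj (qd ^ m) (S (suc j) m) c′ (S j m))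

    eq₀ : p ^ (d ℕ.* suc j) * (1# * S (suc j) 0) + c * (pdj * (1# * S j 0)) ≈ 0#
    eq₀ = trans (combine 0) (trans (*-congˡ (*-congˡ (S-recurrence-zero j)))
      (trans (*-congˡ (zeroʳ _)) (zeroʳ _)))

    eqₛ : ∀ m → p ^ (d ℕ.* suc j) * (qd ^ suc m * S (suc j) (suc m)) + c * (pdj * (qd ^ suc m * S j (suc m)))
               ≈ p ^ (suc d ℕ.* j) * ((q ^ suc d) ^ m * S j m)
    eqₛ m = begin
      _ ≈⟨ combine (suc m) ⟩
      pd * pdj * (qd * qd ^ m * (S (suc j) (suc m) + c′ * S j (suc m)))
        ≈⟨ *-congˡ (*-congˡ (S-recurrence-suc j m)) ⟩
      pd * pdj * (qd * qd ^ m * (p ^ j * (q ^ m * S j m)))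
        ≈⟨ solve 7 (λ pd pdj qd Q P B s → pd :* pdj :* (qd :* Q :* (P :* (B :* s))) :=
             (pd :* qd) :* ((P :* pdj) :* ((B :* Q) :* s))) refl pd pdj qd (qd ^ m) (p ^ j) (q ^ m) (S j m) ⟩
      (pd * qd) * ((p ^ j * pdj) * ((q ^ m * qd ^ m) * S j m))
        ≈⟨ *-cong (pⁿqⁿ≈1 d) (*-cong (sym (^-homo-* p j _)) (*-congʳ (sym (^-distrib-* q qd m)))) ⟩
      1# * (p ^ (suc d ℕ.* j) * ((q ^ suc d) ^ m * S j m)) ≈⟨ *-identityˡ _ ⟩
      _ ∎

  -- Induction on d with the range of k fixed. The bound passes to both recursive calls and at d = 0
  -- puts j inside the range, so that the delta selects S_j.
  pathSum-generating : ∀ n d j → d ℕ.+ j ≤ n →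
    Σ[k≤ n ] (λ k → pathSum k d j • S k) ≋ shiftedS d j
  pathSum-generating n zero j j≤n m = begin
    _ ≈⟨ sum-X^ (suc n) j (s≤s j≤n) (λ k → S k m) ⟩
    S j m ≈⟨ sym (trans (*-identityˡ _) (trans (*-congʳ (1^n≈1 m)) (*-identityˡ _))) ⟩
    1# * (1# ^ m * S j m) ∎
  pathSum-generating n (suc d) j d+j<n m = begin
    sum {suc n} (λ k → (f k + c * g k) * s k)
      ≈⟨ sum-cong-≋ {suc n} (λ k → solve 4 (λ f c g s → (f :+ c :* g) :* s := f :* s :+ c :* (g :* s)) refl (f k) c (g k) (s k)) ⟩
    sum {suc n} (λ k → f k * s k + c * (g k * s k))
      ≈⟨ ∑-distrib-+ {suc n} (λ k → f k * s k) (λ k → c * (g k * s k)) ⟩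
    sum {suc n} (λ k → f k * s k) + sum {suc n} (λ k → c * (g k * s k))
      ≈⟨ +-congˡ (sym (*-distribˡ-sum {suc n} c (λ k → g k * s k))) ⟩
    sum {suc n} (λ k → f k * s k) + c * sum {suc n} (λ k → g k * s k)
      ≈⟨ +-cong (pathSum-generating n d (suc j) (ℕ.≤-trans (ℕ.≤-reflexive (ℕ.+-suc d j)) d+j<n) m)
                (*-congˡ (pathSum-generating n d j (ℕ.<⇒≤ d+j<n) m)) ⟩
    shiftedS d (suc j) m + c * shiftedS d j m ≈⟨ shiftedS-step d j m ⟩
    shiftedS (suc d) j m ∎
    where
    c = p ^ (d ℕ.+ j ℕ.+ j ℕ.+ 1)
    f g s : Fin (suc n) → Carrier
    f k = pathSum (toℕ k) d (suc j)
    g k = pathSum (toℕ k) d j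
    s k = S (toℕ k) m

  pathSum-moments : ∀ n → X^ n ≋ Σ[k≤ n ] (λ k → pathSum k n 0 • S k)
  pathSum-moments n m = sym (begin
    _ ≈⟨ pathSum-generating n n 0 (ℕ.≤-reflexive (ℕ.+-identityʳ n)) m ⟩
    shiftedS n 0 m ≈⟨ shift-cong n only-constant m ⟩
    shift n (S 0) m ≈⟨ shift-S₀ n m ⟩
    (X^ n) m ∎)
    where
    pⁿ⁰≈1 : p ^ (n ℕ.* 0) ≈ 1#
    pⁿ⁰≈1 = ^-congʳ p (ℕ.*-zeroʳ n)
    -- S_0 = 1 is unchanged by x ↦ q^n x.
    only-constant : ∀ m → p ^ (n ℕ.* 0) * ((q ^ n) ^ m * S 0 m) ≈ S 0 m
    only-constant zero    = trans (*-cong pⁿ⁰≈1 (*-identityˡ _)) (*-identityˡ _)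
    only-constant (suc m) = trans
      (*-congˡ (trans (*-congˡ (S₀-upper m)) (zeroʳ _)))
      (trans (zeroʳ _) (sym (S₀-upper m)))

  mixed-moment≈pathSum : ∀ σ → AreMixedMoments σ → ∀ n k → k ≤ n → pathSum k n 0 ≈ σ n k
  mixed-moment≈pathSum σ σ-moments n = coefficients-unique n (λ k → pathSum k n 0) (σ n)
    λ m → trans (sym (pathSum-moments n m)) (σ-moments n m)

  -- Weights of words and the sum over all paths.

  wordWeight : ∀ {k i j} → Word k i j → Carrier
  wordWeight exit                     = 1#
  wordWeight (up _ w)                 = wordWeight w
  wordWeight {i = suc i} {j} (left _ w) = p ^ (i ℕ.+ j ℕ.+ 1) * wordWeight w

  -- For j = 0 the product is `pathWeight weights (path w)` by definition, as `path` gives `size w`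
  -- as the witness of `col-lim`.
  steps-weight : ∀ {k i j} (w : Word k i j) →
    product {size w} (λ m → stepWeight weights (steps w (toℕ m))) ≈ wordWeight w
  steps-weight exit       = refl
  steps-weight (up _ w)   = trans (*-identityˡ _) (steps-weight w)
  steps-weight (left _ w) = *-congˡ (steps-weight w)

  total : ∀ {b} {B : Set b} → (B → Carrier) → List B → Carrier
  total f xs = foldr _+_ 0# (map f xs)

  total-++ : ∀ {b} {B : Set b} (f : B → Carrier) xs ys →
    total f (xs ++ ys) ≈ total f xs + total f ys
  total-++ f []       ys = sym (+-identityˡ _)
  total-++ f (x ∷ xs) ys = trans (+-congˡ (total-++ f xs ys)) (sym (+-assoc _ _ _))

  total-map : ∀ {b b′} {B : Set b} {B′ : Set b′} (f : B → Carrier) (g : B′ → B) (h : B′ → Carrier) x →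
    (∀ y → f (g y) ≈ x * h y) → ∀ ys → total f (map g ys) ≈ x * total h ys
  total-map f g h x eq []       = sym (zeroʳ x)
  total-map f g h x eq (y ∷ ys) =
    trans (+-cong (eq y) (total-map f g h x eq ys)) (sym (distribˡ x _ _))

  words-total : ∀ k d i j eq → total wordWeight (words k d i j eq) ≈ pathSum k d j
  words-total k zero i j ≡.refl with j ℕ.≟ k
  ... | yes ≡.refl = trans (+-identityʳ 1#) (sym (X^-diagonal j))
  ... | no  j≢k    = sym (X^-off-diagonal j k j≢k)
  words-total k (suc d) i j ≡.refl = trans
    (total-++ wordWeight (map (up (s≤s (ℕ.m≤n+m j d))) (words k d _ (suc j) (≡.sym (ℕ.+-suc d j)))) _)
    (+-cong
      (trans (total-map wordWeight _ wordWeight 1# (λ _ → sym (*-identityˡ _)) (words k d _ (suc j) _))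
        (trans (*-identityˡ _) (words-total k d _ (suc j) _)))
      (trans (total-map wordWeight _ wordWeight _ (λ _ → refl) (words k d _ j _))
        (*-congˡ (words-total k d _ j _))))

  low-or-weightless : ∀ {u v} (s : Step u v) → LowStep u v ⊎ stepWeight weights s ≈ 0#
  low-or-weightless (south s)                = inj₁ (inj₁ s)
  low-or-weightless (east (east {zero}  j≤i)) = inj₁ (inj₂ (east j≤i , ≡.refl))
  low-or-weightless (east (east {suc t} j≤i)) = inj₂ refl

  -- From the index N of `col-lim` on, the column is constant and no step is east; before N the
  -- weight of each step is a factor of the nonzero path weight.
  low-steps : ∀ {k n} (x : SE k n) → ¬ pathWeight weights x ≈ 0# →
    ∀ m → LowStep (SE.v x (suc m)) (SE.v x m)
  low-steps x x≉0 m with proj₁ (SE.col-lim x) ℕ.≤? m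
  low-steps x x≉0 m | yes N≤m with SE.step x m
  ... | south s = inj₁ s
  ... | east e  = contradiction
    (≡.trans (≡.sym (east-col e)) (≡.trans (lim m N≤m) (≡.sym (lim (suc m) (ℕ.m≤n⇒m≤1+n N≤m)))))
    ℕ.1+n≢n
    where lim = proj₂ (SE.col-lim x)
  low-steps x x≉0 m | no N≰m with low-or-weightless (SE.step x m)
  ... | inj₁ low = low
  ... | inj₂ w≈0 = contradiction (product-zero _ (fromℕ< m<N)
      (≡.subst (λ m → stepWeight weights (SE.step x m) ≈ 0#) (≡.sym (Fin.toℕ-fromℕ< m<N)) w≈0)) x≉0
    where m<N = ℕ.≰⇒> N≰m

  h-equals-pathSum : ∀ n k → HEquals weights n k (pathSum k n 0)
  h-equals-pathSum n k = map path ws , unique , complete , sum≈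
    where
    n≡n+0 : n ≡ n ℕ.+ 0
    n≡n+0 = ≡.sym (ℕ.+-identityʳ n)
    ws = words k n n 0 n≡n+0
    unique = UniqueSetoid.map⁺ (≡.setoid (Word k n 0)) (SE-setoid k n) {f = path}
      (vertices-injective _ _) (words-unique k n n 0 n≡n+0)
    complete : ∀ x → ¬ pathWeight weights x ≈ 0# →
      SetoidMembership._∈_ (SE-setoid k n) x (map path ws)
    complete x x≉0 =
      let w , x≗w = parse n n≡n+0 (SE.v x) (SE.v₀ x) (low-steps x x≉0) (SE.col-lim x)
      in Any.map⁺ (Any.map (λ { ≡.refl → x≗w }) (words-complete n n≡n+0 w))
    sum≈ : total (pathWeight weights) (map path ws) ≈ pathSum k n 0
    sum≈ = trans (total-map (pathWeight weights) path wordWeight 1#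
                    (λ w → trans (steps-weight w) (sym (*-identityˡ _))) ws)
             (trans (*-identityˡ _) (words-total k n n 0 n≡n+0))

proposition4p3 :
    ∀ {c ℓ₁ ℓ₂} (K : HeytingField c ℓ₁ ℓ₂)
    (q : HeytingField.Carrier K) (q-ind : OverField.IsIndeterminate K q)
    (σ : ℕ → ℕ → HeytingField.Carrier K) →
    OverField.StieltjesWigert.AreMixedMoments K q q-ind σ →
    ∀ n k → k ≤ n →
    OverField.HEquals K (OverField.StieltjesWigert.weights K q q-ind) n k (σ n k)
proposition4p3 K q q-ind σ σ-moments n k k≤n =
  let xs , unique , complete , sum≈ = h-equals-pathSum n k
  in xs , unique , complete , trans sum≈ (mixed-moment≈pathSum σ σ-moments n k k≤n)
  where
  open HeytingField K using (trans)
  open Moments K q q-ind
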